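{- Let $P$ and $Q$ be tabloids of the same shape $\lambda$ with $\lambda_i=\lambda_{i+1}$. Then the dominance constant satisfies \[ r_{i+1}(P,Q)=\operatorname{lch}_i(P)-\operatorname{lch}_i(Q).\]
   Context: Fix $n\ge1$; $\overline i=i+n\mathbb Z$, $[\overline n]=\{\overline1,\dots,\overline n\}$. A tabloid of shape $\lambda$ ($\lambda$ a partition) is a sequence of pairwise disjoint subsets $T_1,T_2,\dots,T_{\ell(\lambda)}$ (rows) of $[\overline n]$ with $|T_r|=\lambda_r$. Broken order: $\overline1<\overline2<\dots<\overline n$. Local charge: suppose rows $k$ and $k+1$ of a tabloid $T$ both have size $m$. List the elements of $T_k$ as $\overline{a_1}<\dots<\overline{a_m}$ in broken order. For $t=1,\dots,m$ in turn, match $\overline{a_t}$ with the smallest (in broken order) not yet matched element of $T_{k+1}$ that is larger than $\overline{a_t}$, if one exists, and otherwise with the smallest not yet matched element of $T_{k+1}$. Then $\operatorname{lch}_k(T)$ is the number of $t$ such that $\overline{a_t}$ is larger (in broken order) than the element it is matched with. Streams: cells are pairs $(i,j)\in\mathbb Z^2$ (row $i$, increasing southward; column $j$, increasing eastward); $(i,j)$ is northwest of $(i',j')$ if $i\le i'$, $j\le j'$; north means smaller row index, west smaller column index. For $A,B\subseteq[\overline n]$ with $|A|=|B|=m\ge1$ and $r\in\mathbb Z$, enumerate $\bigcup A=\{\dots<a_0<a_1<a_2<\dots\}\subseteq\mathbb Z$ with $1\le a_1<\dots<a_m\le n$ and $a_{t+m}=a_t+n$, and similarly $\bigcup B=\{b_t\}$;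 define the stream $\Sigma_r(A,B)=\{(b_t,a_{t+r}):t\in\mathbb Z\}$ (rows from $B$, columns from $A$; $r$ is its altitude). A proper numbering of a stream is an indexing of its cells by $\mathbb Z$, $X^{(t)}$, with $X^{(t+1)}$ southeast of $X^{(t)}$ for all $t$. If $S,T$ are streams with the same $m$, no cell of $S$ sharing a row or column with a cell of $T$, and $S$ is properly numbered, the backward numbering of $T$ with respect to $S$ is the unique proper numbering of $T$ such that $S^{(t)}$ is northwest of $T^{(t)}$ for all $t$ and $S^{(j+1)}$ is not northwest of $T^{(j)}$ for some $j$. Then $T$ is concurrent to $S$ if, with this numbering, there exist $t,j$ with $T^{(t)}$ strictly north of $S^{(t+1)}$ and $T^{(j)}$ strictly west of $S^{(j+1)}$. For tabloids $P,Q$ of shape $\lambda$ with $\lambda_i=\lambda_{i+1}$, the dominance constant $r_{i+1}(P,Q)$ is the unique integer $r$ such that $\Sigma_r(P_{i+1},Q_{i+1})$ is concurrent to $\Sigma_0(P_i,Q_i)$ (such $r$ exists and is unique). -}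

module Defs where

open import Data.Bool.Base using (true; false; if_then_else_)
open import Data.Fin.Base as Fin using (Fin; zero; suc; toℕ; fromℕ<)
open import Data.Fin.Properties using (_<?_)
open import Data.Fin.Subset using (Subset; ∣_∣; _∈_; _∉_)
open import Data.Integer.Base as ℤ using (ℤ; +_; 1ℤ; 0ℤ; _/ℕ_; _%ℕ_)
open import Data.Integer.DivMod using (n%ℕd<d)
open import Data.Maybe.Base as Maybe using (Maybe; just; nothing; fromMaybe)
open import Data.Nat.Base as ℕ using (ℕ; suc; NonZero)
open import Data.Product.Base using (∃; _×_; _,_; proj₁; proj₂)
open import Data.Vec.Base as Vec using (Vec; []; _∷_; lookup; removeAt; count)
open import Function.Definitions using (Injective)
open import Relation.Binary.PropositionalEquality using (_≡_; _≢_; trans)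
open import Relation.Nullary using (¬_; does)

record Partition : Set where
  field
    len        : ℕ
    part       : Fin len → ℕ
    positive   : ∀ k → NonZero (part k)
    decreasing : ∀ {k l} → k Fin.≤ l → part l ℕ.≤ part k

-- The element x of Fin n stands for the residue class of toℕ x + 1, so the
-- broken order is the order of Fin n.
record Row (n m : ℕ) : Set where
  constructor mkRow
  field
    set  : Subset n
    size : ∣ set ∣ ≡ m

record Tabloid (n : ℕ) (shape : Partition) : Set where
  open Partition shape
  field
    row      : (k : Fin len) → Row n (part k)
    disjoint : ∀ {k l} → k ≢ l → ∀ {x} → x ∈ Row.set (row k) → x ∉ Row.set (row l)

resize : ∀ {n m m′} → m ≡ m′ → Row n m → Row n m′
resize eq (mkRow A size) = mkRow A (trans size eq)

-- Members of a subset in increasing order.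
members : ∀ {n} (A : Subset n) → Vec (Fin n) ∣ A ∣
members []          = []
members (true  ∷ A) = zero ∷ Vec.map suc (members A)
members (false ∷ A) = Vec.map suc (members A)

sorted : ∀ {n m} → Row n m → Vec (Fin n) m
sorted (mkRow A size) = Vec.cast size (members A)

firstLarger : ∀ {n k} → Fin n → Vec (Fin n) k → Maybe (Fin k)
firstLarger a []       = nothing
firstLarger a (u ∷ us) =
  if does (a <? u) then just zero else Maybe.map suc (firstLarger a us)

-- Position of the partner of a among the unmatched elements, which are listed
-- in increasing order: "first" is "smallest", and position zero is the
-- smallest unmatched element.
partner : ∀ {n k} → Fin n → Vec (Fin n) (suc k) → Fin (suc k)
partner a us = fromMaybe zero (firstLarger a us)

matching : ∀ {n k} → Vec (Fin n) k → Vec (Fin n) k → Vec (Fin n × Fin n) k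
matching []       []         = []
matching (a ∷ as) us@(_ ∷ _) =
  (a , lookup us (partner a us)) ∷ matching as (removeAt us (partner a us))

rowCharge : ∀ {n m} → Row n m → Row n m → ℕ
rowCharge A B = count (λ ab → proj₂ ab <? proj₁ ab) (matching (sorted A) (sorted B))

-- The local charge lch_i, where j is the index of the row following row i.
lch : ∀ {n shape} → Tabloid n shape → (i j : Fin (Partition.len shape)) →
      Partition.part shape i ≡ Partition.part shape j → ℕ
lch T i j eq = rowCharge (resize eq (Tabloid.row T i)) (Tabloid.row T j)

Cell : Set
Cell = ℤ × ℤ

_NorthwestOf_ : Cell → Cell → Set
(i , j) NorthwestOf (i′ , j′) = (i ℤ.≤ i′) × (j ℤ.≤ j′)

_StrictlyNorthOf_ : Cell → Cell → Set
(i , _) StrictlyNorthOf (i′ , _) = i ℤ.< i′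

_StrictlyWestOf_ : Cell → Cell → Set
(_ , j) StrictlyWestOf (_ , j′) = j ℤ.< j′

-- The enumeration a_t of ⋃A: writing t - 1 = s + q m with 0 ≤ s < m, it is the
-- integer in {1,…,n} representing the (s+1)-st smallest member of A, plus q n.
-- Hence 1 ≤ a_1 < … < a_m ≤ n and a_{t+m} = a_t + n.
enum : ∀ {n m} .{{_ : NonZero m}} → Row n m → ℤ → ℤ
enum {n} {m} A t =
  + suc (toℕ (lookup (sorted A) (fromℕ< (n%ℕd<d (t ℤ.- 1ℤ) m))))
    ℤ.+ ((t ℤ.- 1ℤ) /ℕ m) ℤ.* + n

record Stream (n m : ℕ) : Set where
  constructor Σ⟨_⟩
  field
    altitude : ℤ
    {{size≢0}} : NonZero m
    columns  : Row n m
    rows     : Row n m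

  cellAt : ℤ → Cell
  cellAt t = enum rows t , enum columns (t ℤ.+ altitude)

_∈ˢ_ : ∀ {n m} → Cell → Stream n m → Set
c ∈ˢ S = ∃ λ t → c ≡ Stream.cellAt S t

record ProperNumbering {n m} (S : Stream n m) : Set where
  field
    at         : ℤ → Cell
    sound      : ∀ t → at t ∈ˢ S
    surjective : ∀ {c} → c ∈ˢ S → ∃ λ t → at t ≡ c
    injective  : Injective _≡_ _≡_ at
    southeast  : ∀ t → at t NorthwestOf at (t ℤ.+ 1ℤ)

open ProperNumbering using (at)

NoSharedLine : ∀ {n m} → Stream n m → Stream n m → Set
NoSharedLine S T = ∀ {c d} → c ∈ˢ S → d ∈ˢ T → (proj₁ c ≢ proj₁ d) × (proj₂ c ≢ proj₂ d)

IsBackward : ∀ {n m} {S T : Stream n m} → ProperNumbering S → ProperNumbering T → Set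
IsBackward X Y =
  (∀ t → at X t NorthwestOf at Y t) ×
  (∃ λ j → ¬ (at X (j ℤ.+ 1ℤ) NorthwestOf at Y j))

-- Shifting the numbering X of S shifts the backward numbering Y of T along with
-- it, so the choice of X is immaterial.
record _ConcurrentTo_ {n m} (T S : Stream n m) : Set where
  field
    noSharedLine : NoSharedLine S T
    X            : ProperNumbering S
    Y            : ProperNumbering T
    backward     : IsBackward X Y
    north        : ∃ λ t → at Y t StrictlyNorthOf at X (t ℤ.+ 1ℤ)
    west         : ∃ λ j → at Y j StrictlyWestOf at X (j ℤ.+ 1ℤ)

module _ {n : ℕ} {shape : Partition} (P Q : Tabloid n shape) where
  open Partition shape
  open Tabloid

  ConcurrentAt : (i j : Fin len) → part i ≡ part j → ℤ → Set
  ConcurrentAt i j eq r =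
    Σ⟨ r ⟩ {{positive j}} (row P j) (row Q j)
      ConcurrentTo
    Σ⟨ 0ℤ ⟩ {{positive j}} (resize eq (row P i)) (resize eq (row Q i))

  -- "r is the dominance constant r_j(P,Q)", for j the index following i: the
  -- definite description is rendered as existence together with uniqueness.
  IsDominanceConstant : (i j : Fin len) → part i ≡ part j → ℤ → Set
  IsDominanceConstant i j eq r =
    ConcurrentAt i j eq r × (∀ r′ → ConcurrentAt i j eq r′ → r′ ≡ r)

{-# OPTIONS --safe #-}
module Submission where

-- For a row A followed by a row A′ disjoint from it, let c(A, A′) be the least c with
-- a_t ≤ a′_{t+c} for all t. A proper numbering of a stream is a translate of its standard
-- indexing, so the backward numbering of Σ_r(P_{i+1}, Q_{i+1}) with respect to
-- Σ_0(P_i, Q_i) is a shift s satisfying s ≥ c(Q_i, Q_{i+1}) and s + r ≥ c(P_i, P_{i+1});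
-- the two concurrency conditions turn both inequalities into equalities, so that
-- r = c(P_i, P_{i+1}) − c(Q_i, Q_{i+1}). Finally c(A, A′) is the local charge: the greedy
-- matching leaves exactly as many elements of A without a larger partner as A′ has
-- to be shifted by in order to dominate A entrywise.

open import Defs
open import Data.Bool.Base using (true; false)
open import Data.Fin.Base as Fin using (Fin; zero; suc; toℕ; fromℕ; fromℕ<; inject₁)
open import Data.Fin.Properties as Fin using (toℕ-fromℕ<; toℕ-fromℕ; toℕ-inject₁; toℕ-injective; toℕ<n)
open import Data.Fin.Subset using (Subset; _∈_; _∉_)
open import Data.Integer.Base as ℤ using (ℤ; +_; -[1+_]; _-_; 0ℤ; 1ℤ; _/ℕ_; _%ℕ_; +<+; +≤+)
open import Data.Integer.DivMod using (n%ℕd<d; a≡a%ℕn+[a/ℕn]*n)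
import Data.Integer.Properties as ℤ
open import Data.Integer.Tactic.RingSolver using (solve-∀)
open import Data.Maybe.Base using (Maybe; just; nothing; fromMaybe)
open import Data.Nat.Base as ℕ using (ℕ; zero; suc; z≤n; s≤s; NonZero)
import Data.Nat.Properties as ℕ
open import Data.Product.Base using (∃; ∃₂; _×_; _,_; proj₁; proj₂)
open import Data.Sum.Base using (_⊎_; inj₁; inj₂)
open import Data.Vec.Base using (Vec; []; _∷_; lookup; removeAt; count; here; there)
open import Data.Vec.Properties using (count≤n; lookup-map; cast-is-id)
open import Function.Base using (_∘_; _∘′_)
open import Relation.Binary.Definitions using (tri<; tri≈; tri>)
open import Relation.Binary.PropositionalEquality
open import Relation.Nullary using (¬_; yes; no; contradiction)
open import Relation.Nullary.Decidable using (dec-true; dec-false)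
open import Relation.Unary using (Decidable; Pred)
open import Algebra.Properties.AbelianGroup ℤ.+-0-abelianGroup using () renaming (∙-cancelˡ to +-cancelˡ; ∙-cancelʳ to +-cancelʳ)

private variable
  n m k : ℕ

-- Counting and deletion in vectors

module _ {a p} {A : Set a} {P : Pred A p} (P? : Decidable P) where

  count-accept : ∀ x (xs : Vec A k) → P x → count P? (x ∷ xs) ≡ suc (count P? xs)
  count-accept x xs px with P? x
  ... | yes _  = refl
  ... | no ¬px = contradiction px ¬px

  count-reject : ∀ x (xs : Vec A k) → ¬ P x → count P? (x ∷ xs) ≡ count P? xs
  count-reject x xs ¬px with P? x
  ... | yes px = contradiction px ¬px
  ... | no _   = refl

lookup-removeAt : ∀ {a} {A : Set a} (xs : Vec A (suc k)) p j →
  (j Fin.< p × lookup (removeAt xs p) j ≡ lookup xs (inject₁ j)) ⊎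
  (p Fin.≤ j × lookup (removeAt xs p) j ≡ lookup xs (suc j))
lookup-removeAt (_ ∷ _)          zero    j       = inj₂ (z≤n , refl)
lookup-removeAt (_ ∷ _ ∷ _)      (suc p) zero    = inj₁ (s≤s z≤n , refl)
lookup-removeAt (_ ∷ xs@(_ ∷ _)) (suc p) (suc j) with lookup-removeAt xs p j
... | inj₁ (j<p , eq) = inj₁ (s≤s j<p , eq)
... | inj₂ (p≤j , eq) = inj₂ (s≤s p≤j , eq)

-- Complements `lookup-removeAt`, whose index refers to the shortened vector: here the given index
-- refers to the original one.
lookup-removeAt-< : ∀ {a} {A : Set a} (xs : Vec A (suc k)) {p j} → j Fin.< p →
  ∃ λ j′ → toℕ j′ ≡ toℕ j × lookup (removeAt xs p) j′ ≡ lookup xs j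
lookup-removeAt-< (_ ∷ _ ∷ _)      {suc p} {zero}  _         = zero , refl , refl
lookup-removeAt-< (_ ∷ xs@(_ ∷ _)) {suc p} {suc j} (s≤s j<p) =
  let j′ , j′≡j , eq = lookup-removeAt-< xs j<p in suc j′ , cong suc j′≡j , eq

-- Increasing vectors without common entries

Increasing : Vec (Fin n) k → Set
Increasing us = ∀ {i j} → i Fin.< j → lookup us i Fin.< lookup us j

Apart : Vec (Fin n) k → Vec (Fin n) m → Set
Apart as us = ∀ i j → lookup as i ≢ lookup us j

increasing-≤ : (us : Vec (Fin n) k) → Increasing us →
               ∀ {i j} → i Fin.≤ j → lookup us i Fin.≤ lookup us j
increasing-≤ us us↗ {i} {j} i≤j with ℕ.m≤n⇒m<n∨m≡n i≤j
... | inj₁ i<j = ℕ.<⇒≤ (us↗ i<j)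
... | inj₂ i≡j rewrite toℕ-injective i≡j = ℕ.≤-refl

increasing-tail : ∀ {a} (as : Vec (Fin n) k) → Increasing (a ∷ as) → Increasing as
increasing-tail as as↗ i<j = as↗ (s≤s i<j)

removeAt-increasing : (us : Vec (Fin n) (suc k)) → Increasing us →
                      ∀ p → Increasing (removeAt us p)
removeAt-increasing us us↗ p {i} {j} i<j with lookup-removeAt us p i | lookup-removeAt us p j
... | inj₁ (_ , eq) | inj₁ (_ , eq′) rewrite eq | eq′ =
  us↗ (subst₂ ℕ._<_ (sym (toℕ-inject₁ i)) (sym (toℕ-inject₁ j)) i<j)
... | inj₁ (_ , eq) | inj₂ (_ , eq′) rewrite eq | eq′ =
  us↗ (subst (ℕ._< _) (sym (toℕ-inject₁ i)) (ℕ.m<n⇒m<1+n i<j))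
... | inj₂ (p≤i , _) | inj₁ (j<p , _) =
  contradiction (ℕ.<-trans i<j j<p) (ℕ.≤⇒≯ p≤i)
... | inj₂ (_ , eq) | inj₂ (_ , eq′) rewrite eq | eq′ = us↗ (s≤s i<j)

removeAt-apart : ∀ {a} (as : Vec (Fin n) k) (us : Vec (Fin n) (suc k)) →
                 Apart (a ∷ as) us → ∀ p → Apart as (removeAt us p)
removeAt-apart as us as#us p i j eq with lookup-removeAt us p j
... | inj₁ (_ , eq′) = as#us (suc i) (inject₁ j) (trans eq eq′)
... | inj₂ (_ , eq′) = as#us (suc i) (suc j) (trans eq eq′)

-- The greedy matching and its charge

data FirstLarger (a : Fin n) (us : Vec (Fin n) k) : Maybe (Fin k) → Set where
  some : ∀ {p} → a Fin.< lookup us p → (∀ j → j Fin.< p → lookup us j Fin.≤ a) →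
         FirstLarger a us (just p)
  none : (∀ j → lookup us j Fin.≤ a) → FirstLarger a us nothing

firstLarger-spec : (a : Fin n) (us : Vec (Fin n) k) → FirstLarger a us (firstLarger a us)
firstLarger-spec a []       = none λ ()
firstLarger-spec a (u ∷ us) with a Fin.<? u
... | yes a<u rewrite dec-true (a Fin.<? u) a<u = some a<u λ _ ()
... | no a≮u rewrite dec-false (a Fin.<? u) a≮u with firstLarger a us | firstLarger-spec a us
...   | _ | some a<uₚ u≤a = some a<uₚ λ
  { zero    _         → ℕ.≮⇒≥ a≮u
  ; (suc j) (s≤s j<p) → u≤a j j<p }
...   | _ | none u≤a = none λ
  { zero    → ℕ.≮⇒≥ a≮u
  ; (suc j) → u≤a j }

Wraps : Pred (Fin n × Fin n) _
Wraps (a , b) = b Fin.< a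

wraps? : Decidable (Wraps {n})
wraps? (a , b) = b Fin.<? a

charge : Vec (Fin n) k → Vec (Fin n) k → ℕ
charge as us = count wraps? (matching as us)

charge≤ : (as us : Vec (Fin n) k) → charge as us ℕ.≤ k
charge≤ as us = count≤n wraps? (matching as us)

charge-accept : ∀ a (as : Vec (Fin n) k) us → lookup us (partner a us) Fin.< a →
  charge (a ∷ as) us ≡ suc (charge as (removeAt us (partner a us)))
charge-accept a as us@(_ ∷ _) = count-accept wraps? _ (matching as (removeAt us (partner a us)))

charge-reject : ∀ a (as : Vec (Fin n) k) us → ¬ lookup us (partner a us) Fin.< a →
  charge (a ∷ as) us ≡ charge as (removeAt us (partner a us))
charge-reject a as us@(_ ∷ _) = count-reject wraps? _ (matching as (removeAt us (partner a us)))

-- Whatever partner is removed, the remaining entries still lie below all of `as`, so every step of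
-- the matching wraps.
charge-all : (as us : Vec (Fin n) k) → (∀ i j → lookup us j Fin.< lookup as i) →
             charge as us ≡ k
charge-all []       []         us<as = refl
charge-all (a ∷ as) us@(_ ∷ _) us<as =
  trans (charge-accept a as us (us<as zero (partner a us))) (cong suc (charge-all as _ below))
  where
  below : ∀ i j → lookup (removeAt us (partner a us)) j Fin.< lookup as i
  below i j with lookup-removeAt us (partner a us) j
  ... | inj₁ (_ , eq) rewrite eq = us<as (suc i) (inject₁ j)
  ... | inj₂ (_ , eq) rewrite eq = us<as (suc i) (suc j)

-- The charge as a least dominating shift

-- The form of c(A, A′) within one period. `below` tests the shift by c only where the shifted index
-- stays in range; `above` refutes the shift by c - 1, hence the guard 0 < c. Writing `suc (toℕ j)`
-- avoids truncated subtraction.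
record LeastShift (as us : Vec (Fin n) k) (c : ℕ) : Set where
  field
    below : ∀ i j → toℕ j ≡ toℕ i ℕ.+ c → lookup as i Fin.< lookup us j
    above : 0 ℕ.< c → ∃₂ λ i j → suc (toℕ j) ≡ toℕ i ℕ.+ c × lookup us j Fin.< lookup as i

open LeastShift

min-index : Fin k → ∃ λ (i : Fin k) → toℕ i ≡ 0
min-index {suc k} _ = zero , refl

-- A shift by the full length leaves no index in range, so `below` is vacuous; the shift by one less
-- compares `a` with the last entry of `us` and fails.
leastShift-wrapped : (a : Fin n) (as : Vec (Fin n) k) (us : Vec (Fin n) (suc k)) →
                     (∀ j → lookup us j Fin.< a) → LeastShift (a ∷ as) us (suc k)
leastShift-wrapped {k = k} a as us us<a .below i j eq =
  contradiction (toℕ<n j) (ℕ.≤⇒≯ (subst (suc k ℕ.≤_) (sym eq) (ℕ.m≤n+m (suc k) (toℕ i))))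
leastShift-wrapped {k = k} a as us us<a .above _ =
  zero , fromℕ k , cong suc (toℕ-fromℕ k) , us<a (fromℕ k)

module _ (a : Fin n) (as : Vec (Fin n) k) (us : Vec (Fin n) (suc k))
         (as↗ : Increasing (a ∷ as)) (us↗ : Increasing us) where

  module _ {p : Fin (suc k)} (a<uₚ : a Fin.< lookup us p)
           (u<a : ∀ j → j Fin.< p → lookup us j Fin.< a)
           {c : ℕ} (ih : LeastShift as (removeAt us p) c) where

    -- A skipped element at position c would lie below a, hence below the first
    -- entry of as, against ih.
    not-skipped : ∀ j → toℕ j ≡ c → p Fin.≤ j
    not-skipped j j≡c = ℕ.≮⇒≥ λ j<p →
      let j′ , j′≡j , u≡  = lookup-removeAt-< us j<p
          i₀ , i₀≡0       = min-index j′
          as₀<u = subst (lookup as i₀ Fin.<_) u≡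
            (ih .below i₀ j′ (trans j′≡j (trans j≡c (cong (ℕ._+ c) (sym i₀≡0)))))
      in ℕ.<-asym as₀<u (ℕ.<-trans (u<a j j<p) (as↗ {zero} {suc i₀} (s≤s z≤n)))

    -- For `a` itself, index c is at or after p, so its entry is at least u_p and thus above `a`.
    -- For the other entries both indices drop by one, and entry j of the shortened vector is u_j or
    -- u_{j+1}, hence at most u_{j+1}.
    leastShift-found : LeastShift (a ∷ as) us c
    leastShift-found .below zero j eq =
      ℕ.<-≤-trans a<uₚ (increasing-≤ us us↗ (not-skipped j eq))
    leastShift-found .below (suc i) (suc j) eq with lookup-removeAt us p j | ih .below i j (ℕ.suc-injective eq)
    ... | inj₁ (_ , eq′) | lt rewrite eq′ =
      ℕ.<-trans lt (us↗ (subst (ℕ._< suc (toℕ j)) (sym (toℕ-inject₁ j)) ℕ.≤-refl))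
    ... | inj₂ (_ , eq′) | lt rewrite eq′ = lt
    leastShift-found .above 0<c with ih .above 0<c
    ... | i , j , eq , uⱼ<asᵢ with lookup-removeAt us p j
    ...   | inj₂ (_ , eq′) = suc i , suc j , cong suc eq , subst (λ u → u Fin.< lookup as i) eq′ uⱼ<asᵢ
    -- The inductive witness lies before p and cannot be moved up by one. But c - 1 ≤ j < p, so
    -- entry c - 1 was passed over as smaller than `a`, and `a` at index 0 is a witness instead.
    ...   | inj₁ (j<p , _) = zero , l , l≡ , u<a l l<p
      where
      c≤1+j : c ℕ.≤ suc (toℕ j)
      c≤1+j = subst (c ℕ.≤_) (sym eq) (ℕ.m≤n+m c (toℕ i))
      l<  : ℕ.pred c ℕ.< suc k
      l< = ℕ.≤-<-trans (ℕ.pred-mono-≤ c≤1+j) (ℕ.m<n⇒m<1+n (toℕ<n j))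
      l : Fin (suc k)
      l = fromℕ< l<
      l≡ : suc (toℕ l) ≡ c
      l≡ = trans (cong suc (toℕ-fromℕ< l<)) (ℕ.suc-pred c {{ℕ.>-nonZero 0<c}})
      l<p : l Fin.< p
      l<p = ℕ.≤-<-trans (ℕ.≤-pred (subst (ℕ._≤ suc (toℕ j)) (sym l≡) c≤1+j)) j<p

-- Induction on the matching. A partner larger than `a` changes neither the charge nor the least
-- shift. If there is none, all of `us` lies below `a`, hence below all later entries of `as`, and
-- both numbers equal the full length.
charge-leastShift : (as us : Vec (Fin n) k) → Increasing as → Increasing us → Apart as us →
                    LeastShift as us (charge as us)
charge-leastShift []       []         _   _   _     = record { below = λ () ; above = λ () }
charge-leastShift {k = suc k} (a ∷ as) us as↗ us↗ as#us
  with firstLarger a us in eq | firstLarger-spec a us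
... | just p | some a<uₚ u≤a = subst (LeastShift (a ∷ as) us) (sym chargeEq)
  (leastShift-found a as us as↗ us↗ a<uₚ
    (λ j j<p → ℕ.≤∧≢⇒< (u≤a j j<p) (as#us zero j ∘ sym ∘ toℕ-injective))
    (charge-leastShift as (removeAt us p) (increasing-tail as as↗)
      (removeAt-increasing us us↗ p) (removeAt-apart as us as#us p)))
  where
  p≡ : partner a us ≡ p
  p≡ = cong (fromMaybe zero) eq
  chargeEq : charge (a ∷ as) us ≡ charge as (removeAt us p)
  chargeEq = trans
    (charge-reject a as us
      (ℕ.<-asym (subst (λ q → a Fin.< lookup us q) (sym p≡) a<uₚ)))
    (cong (λ q → charge as (removeAt us q)) p≡)
... | nothing | none u≤a = subst (LeastShift (a ∷ as) us) (sym chargeEq)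
  (leastShift-wrapped a as us us<a)
  where
  us<a : ∀ j → lookup us j Fin.< a
  us<a j = ℕ.≤∧≢⇒< (u≤a j) (as#us zero j ∘ sym ∘ toℕ-injective)
  chargeEq : charge (a ∷ as) us ≡ suc k
  chargeEq = charge-all (a ∷ as) us λ
    { zero    j → us<a j
    ; (suc i) j → ℕ.<-trans (us<a j) (as↗ {zero} {suc i} (s≤s z≤n)) }

-- Rows as increasing vectors

members-∈ : (A : Subset n) → ∀ i → lookup (members A) i ∈ A
members-∈ (true ∷ A)  zero    = here
members-∈ (true ∷ A)  (suc i) rewrite lookup-map i Fin.suc (members A) = there (members-∈ A i)
members-∈ (false ∷ A) i       rewrite lookup-map i Fin.suc (members A) = there (members-∈ A i)

members-increasing : (A : Subset n) → Increasing (members A)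
members-increasing (true ∷ A) {zero} {suc j} _
  rewrite lookup-map j Fin.suc (members A) = s≤s z≤n
members-increasing (true ∷ A) {suc i} {suc j} (s≤s i<j)
  rewrite lookup-map i Fin.suc (members A) | lookup-map j Fin.suc (members A) =
  s≤s (members-increasing A i<j)
members-increasing (false ∷ A) {i} {j} i<j
  rewrite lookup-map i Fin.suc (members A) | lookup-map j Fin.suc (members A) =
  s≤s (members-increasing A i<j)

sorted-∈ : (A : Row n m) → ∀ i → lookup (sorted A) i ∈ Row.set A
sorted-∈ (mkRow A refl) i rewrite cast-is-id refl (members A) = members-∈ A i

sorted-increasing : (A : Row n m) → Increasing (sorted A)
sorted-increasing (mkRow A refl) rewrite cast-is-id refl (members A) = members-increasing A

DisjointRows : Row n m → Row n m → Set
DisjointRows A B = ∀ {x} → x ∈ Row.set A → x ∉ Row.set B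

sorted-apart : (A B : Row n m) → DisjointRows A B → Apart (sorted A) (sorted B)
sorted-apart A B A#B i j eq =
  A#B (sorted-∈ A i) (subst (_∈ Row.set B) (sym eq) (sorted-∈ B j))

rowCharge-leastShift : (A B : Row n m) → DisjointRows A B →
                       LeastShift (sorted A) (sorted B) (rowCharge A B)
rowCharge-leastShift A B A#B = charge-leastShift (sorted A) (sorted B)
  (sorted-increasing A) (sorted-increasing B) (sorted-apart A B A#B)

-- Division with remainder and the periodic enumeration

i<suc[i] : ∀ i → i ℤ.< ℤ.suc i
i<suc[i] i = ℤ.suc[i]≤j⇒i<j ℤ.≤-refl

-- The larger quotient contributes at least one more d, which outweighs s - s′. Bounding only this
-- difference covers both remainders 0,...,m-1 (indices) and 1,...,n (values).
lex-< : ∀ {d s s′ q q′} → s ℕ.< s′ ℕ.+ d → q ℤ.< q′ →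
        + s ℤ.+ q ℤ.* + d ℤ.< + s′ ℤ.+ q′ ℤ.* + d
lex-< {d} {s} {s′} {q} {q′} s<s′+d q<q′ = begin-strict
  + s ℤ.+ q ℤ.* + d               <⟨ ℤ.+-monoˡ-< (q ℤ.* + d) (+<+ s<s′+d) ⟩
  (+ s′ ℤ.+ + d) ℤ.+ q ℤ.* + d    ≡⟨ regroup (+ s′) (+ d) q ⟩
  + s′ ℤ.+ (1ℤ ℤ.+ q) ℤ.* + d     ≤⟨ ℤ.+-monoʳ-≤ (+ s′) (ℤ.*-monoʳ-≤-nonNeg (+ d) (ℤ.i<j⇒suc[i]≤j q<q′)) ⟩
  + s′ ℤ.+ q′ ℤ.* + d             ∎
  where
  open ℤ.≤-Reasoning
  regroup : ∀ s d q → (s ℤ.+ d) ℤ.+ q ℤ.* d ≡ s ℤ.+ (1ℤ ℤ.+ q) ℤ.* d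
  regroup = solve-∀

lex-injective : ∀ {d s s′ q q′} → s ℕ.< s′ ℕ.+ d → s′ ℕ.< s ℕ.+ d →
  + s ℤ.+ q ℤ.* + d ≡ + s′ ℤ.+ q′ ℤ.* + d → s ≡ s′ × q ≡ q′
lex-injective {d} {s} {s′} {q} {q′} s< s′< eq with ℤ.<-cmp q q′
... | tri< q<q′ _ _ = contradiction eq (ℤ.<⇒≢ (lex-< s< q<q′))
... | tri> _ _ q>q′ = contradiction (sym eq) (ℤ.<⇒≢ (lex-< s′< q>q′))
... | tri≈ _ refl _ = ℤ.+-injective (+-cancelʳ (q ℤ.* + d) (+ s) (+ s′) eq) , refl

-- A view of an integer in the form in which `enum` divides it: matching on `locate m t` replaces t
-- by a place s within a period and the number q of the period.
data Position (m : ℕ) : ℤ → Set where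
  position : (s : Fin m) (q : ℤ) → Position m (1ℤ ℤ.+ (+ toℕ s ℤ.+ q ℤ.* + m))

locate : ∀ m .{{_ : NonZero m}} t → Position m t
locate m t = subst (Position m) (trans (cong ℤ.suc (sym decompose)) (cancel t))
                   (position (fromℕ< (n%ℕd<d u m)) (u /ℕ m))
  where
  u = t ℤ.- 1ℤ
  cancel : ∀ t → 1ℤ ℤ.+ (t ℤ.- 1ℤ) ≡ t
  cancel = solve-∀
  decompose : u ≡ + toℕ (fromℕ< (n%ℕd<d u m)) ℤ.+ (u /ℕ m) ℤ.* + m
  decompose = trans (a≡a%ℕn+[a/ℕn]*n u m)
    (cong (λ s → + s ℤ.+ (u /ℕ m) ℤ.* + m) (sym (toℕ-fromℕ< (n%ℕd<d u m))))

module _ .{{_ : NonZero m}} (A : Row n m) where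

  -- Uniqueness of quotient and remainder removes the division from `enum`.
  enum-position : ∀ s q → enum A (1ℤ ℤ.+ (+ toℕ s ℤ.+ q ℤ.* + m)) ≡
                          + suc (toℕ (lookup (sorted A) s)) ℤ.+ q ℤ.* + n
  enum-position s q = cong₂ (λ s q → + suc (toℕ (lookup (sorted A) s)) ℤ.+ q ℤ.* + n)
    (toℕ-injective (trans (toℕ-fromℕ< _) (proj₁ same))) (proj₂ same)
    where
    z = + toℕ s ℤ.+ q ℤ.* + m
    u = (1ℤ ℤ.+ z) ℤ.- 1ℤ
    cancel : ∀ z → (1ℤ ℤ.+ z) ℤ.- 1ℤ ≡ z
    cancel = solve-∀
    same : u %ℕ m ≡ toℕ s × u /ℕ m ≡ q
    same = lex-injective (ℕ.m≤n⇒m≤o+n (toℕ s) (n%ℕd<d u m)) (ℕ.m≤n⇒m≤o+n (u %ℕ m) (toℕ<n s))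
      (trans (sym (a≡a%ℕn+[a/ℕn]*n u m)) (cancel z))

StrictlyIncreasing : (ℤ → ℤ) → Set
StrictlyIncreasing e = ∀ {t u} → t ℤ.< u → e t ℤ.< e u

class-bound : (x y : Fin n) → suc (toℕ x) ℕ.< suc (toℕ y) ℕ.+ n
class-bound x y = s≤s (ℕ.m≤n⇒m≤o+n (toℕ y) (toℕ<n x))

module _ .{{_ : NonZero m}} (A : Row n m) where

  enum-strictlyIncreasing : StrictlyIncreasing (enum A)
  enum-strictlyIncreasing {t} {u} t<u with locate m t | locate m u
  ... | position s q | position s′ q′ rewrite enum-position A s q | enum-position A s′ q′
    with ℤ.<-cmp q q′
  ...   | tri< q<q′ _ _ = lex-< (class-bound (lookup (sorted A) s) (lookup (sorted A) s′)) q<q′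
  ...   | tri> _ _ q>q′ = contradiction t<u
          (ℤ.<-asym (ℤ.+-monoʳ-< 1ℤ (lex-< (ℕ.m≤n⇒m≤o+n (toℕ s) (toℕ<n s′)) q>q′)))
  ...   | tri≈ _ refl _ with s Fin.<? s′
  ...     | yes s<s′ = ℤ.+-monoˡ-< (q ℤ.* + n) (+<+ (s≤s (sorted-increasing A s<s′)))
  ...     | no s≮s′  = contradiction t<u
            (ℤ.≤⇒≯ (ℤ.+-monoʳ-≤ 1ℤ (ℤ.+-monoˡ-≤ (q ℤ.* + m) (+≤+ (ℕ.≮⇒≥ s≮s′)))))

enum-apart : .{{_ : NonZero m}} (A B : Row n m) → DisjointRows A B →
             ∀ t u → enum A t ≢ enum B u
enum-apart {m} A B A#B t u eq with locate m t | locate m u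
... | position s q | position s′ q′ rewrite enum-position A s q | enum-position B s′ q′ =
  sorted-apart A B A#B s s′ (toℕ-injective (ℕ.suc-injective
    (proj₁ (lex-injective {q = q} {q′ = q′} (class-bound x y) (class-bound y x) eq))))
  where
  x = lookup (sorted A) s
  y = lookup (sorted B) s′

-- Strictly increasing sequences and their offsets

module _ {e : ℤ → ℤ} (e↗ : StrictlyIncreasing e) where

  reflects-≤ : ∀ {t u} → e t ℤ.≤ e u → t ℤ.≤ u
  reflects-≤ et≤eu = ℤ.≮⇒≥ (λ u<t → ℤ.≤⇒≯ et≤eu (e↗ u<t))

  preserves-≤ : ∀ {t u} → t ℤ.≤ u → e t ℤ.≤ e u
  preserves-≤ {t} {u} t≤u with ℤ._≟_ t u
  ... | yes refl = ℤ.≤-refl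
  ... | no t≢u   = ℤ.<⇒≤ (e↗ (ℤ.≤∧≢⇒< t≤u t≢u))

  strictlyIncreasing⇒injective : ∀ {t u} → e t ≡ e u → t ≡ u
  strictlyIncreasing⇒injective eq =
    ℤ.≤-antisym (reflects-≤ (ℤ.≤-reflexive eq)) (reflects-≤ (ℤ.≤-reflexive (sym eq)))

-- For increasing f this says that s is least with e t ≤ f (t + s) for all t: it is
-- c(A, A′) when e and f enumerate A and A′.
Offset : (e f : ℤ → ℤ) → ℤ → Set
Offset e f s = (∀ t → e t ℤ.≤ f (t ℤ.+ s)) × (∃ λ t → f (t ℤ.+ s) ℤ.< e (t ℤ.+ 1ℤ))

module _ {e f : ℤ → ℤ} (f↗ : StrictlyIncreasing f) where

  -- The witness for s′ says that the shift by s′ - 1 fails at t + 1. As f increases, every smaller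
  -- shift fails there too, so s cannot be smaller than s′.
  offset-≤ : ∀ {s s′} → Offset e f s → Offset e f s′ → s′ ℤ.≤ s
  offset-≤ {s} {s′} (e≤f , _) (_ , t , f<e) = ℤ.≮⇒≥ λ s<s′ → ℤ.<⇒≱ f<e (begin
    e (t ℤ.+ 1ℤ)            ≤⟨ e≤f (t ℤ.+ 1ℤ) ⟩
    f ((t ℤ.+ 1ℤ) ℤ.+ s)    ≡⟨ cong f (ℤ.+-assoc t 1ℤ s) ⟩
    f (t ℤ.+ (1ℤ ℤ.+ s))    ≤⟨ preserves-≤ f↗ (ℤ.+-monoʳ-≤ t (ℤ.i<j⇒suc[i]≤j s<s′)) ⟩
    f (t ℤ.+ s′)            ∎)
    where open ℤ.≤-Reasoning

  offset-unique : ∀ {s s′} → Offset e f s → Offset e f s′ → s ≡ s′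
  offset-unique p p′ = ℤ.≤-antisym (offset-≤ p′ p) (offset-≤ p p′)

-- Reads an offset off two numberings translated by x and y: only y - x matters. The maps g and h
-- absorb index expressions such as (t + y) + r, where an altitude is added.
offset-reindex : ∀ (e f : ℤ → ℤ) {x y : ℤ} {g h : ℤ → ℤ} →
  (∀ t → g t ≡ t ℤ.+ x) → (∀ t → h t ≡ t ℤ.+ y) →
  (∀ t → e (g t) ℤ.≤ f (h t)) → (∃ λ t → f (h t) ℤ.< e (g (t ℤ.+ 1ℤ))) →
  Offset e f (y ℤ.- x)
offset-reindex e f {x} {y} {g} {h} g≡ h≡ e≤f (t , f<e) =
  (λ t → subst₂ (λ a b → e a ℤ.≤ f b)
    (trans (g≡ (t ℤ.- x)) (cancel t x)) (trans (h≡ (t ℤ.- x)) (move t x y)) (e≤f (t ℤ.- x))) ,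
  t ℤ.+ x , subst₂ (λ a b → f a ℤ.< e b)
    (trans (h≡ t) (insert t x y)) (trans (g≡ (t ℤ.+ 1ℤ)) (swap t x)) f<e
  where
  cancel : ∀ t x → (t ℤ.- x) ℤ.+ x ≡ t
  cancel = solve-∀
  move : ∀ t x y → (t ℤ.- x) ℤ.+ y ≡ t ℤ.+ (y ℤ.- x)
  move = solve-∀
  insert : ∀ t x y → t ℤ.+ y ≡ (t ℤ.+ x) ℤ.+ (y ℤ.- x)
  insert = solve-∀
  swap : ∀ t x → (t ℤ.+ 1ℤ) ℤ.+ x ≡ (t ℤ.+ x) ℤ.+ 1ℤ
  swap = solve-∀

-- Extends the least shift from one period to all integers. An index pushed past the end of its
-- period lands in the next one, where every value of B exceeds the given value of A.
enum-offset : .{{_ : NonZero m}} (A B : Row n m) → DisjointRows A B →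
              Offset (enum A) (enum B) (+ rowCharge A B)
enum-offset {m = m@(suc m-1)} {n = n} A B A#B = lower , exceed
  where
  open ℤ.≤-Reasoning
  shift : LeastShift (sorted A) (sorted B) (rowCharge A B)
  shift = rowCharge-leastShift A B A#B
  c = rowCharge A B

  as bs : Fin m → Fin n
  as = lookup (sorted A)
  bs = lookup (sorted B)

  regroup : ∀ s q m c → (1ℤ ℤ.+ (s ℤ.+ q ℤ.* m)) ℤ.+ c ≡ 1ℤ ℤ.+ ((s ℤ.+ c) ℤ.+ q ℤ.* m)
  regroup = solve-∀

  carry : ∀ s q m → (s ℤ.+ m) ℤ.+ q ℤ.* m ≡ s ℤ.+ (1ℤ ℤ.+ q) ℤ.* m
  carry = solve-∀

  lower : ∀ t → enum A t ℤ.≤ enum B (t ℤ.+ + c)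
  lower t with locate m t
  ... | position s q rewrite enum-position A s q | regroup (+ toℕ s) q (+ m) (+ c)
    with toℕ s ℕ.+ c ℕ.<? m
  ...   | yes s+c<m = ℤ.<⇒≤ (begin-strict
      + suc (toℕ (as s)) ℤ.+ q ℤ.* + n
        <⟨ ℤ.+-monoˡ-< (q ℤ.* + n) (+<+ (s≤s (shift .below s j j≡))) ⟩
      + suc (toℕ (bs j)) ℤ.+ q ℤ.* + n
        ≡⟨ enum-position B j q ⟨
      enum B (1ℤ ℤ.+ (+ toℕ j ℤ.+ q ℤ.* + m))
        ≡⟨ cong (λ j → enum B (1ℤ ℤ.+ (+ j ℤ.+ q ℤ.* + m))) j≡ ⟩
      enum B (1ℤ ℤ.+ (+ (toℕ s ℕ.+ c) ℤ.+ q ℤ.* + m)) ∎)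
    where
    j = fromℕ< s+c<m
    j≡ : toℕ j ≡ toℕ s ℕ.+ c
    j≡ = toℕ-fromℕ< s+c<m
  ...   | no s+c≮m = ℤ.<⇒≤ (begin-strict
      + suc (toℕ (as s)) ℤ.+ q ℤ.* + n
        <⟨ lex-< (class-bound (as s) (bs j)) (i<suc[i] q) ⟩
      + suc (toℕ (bs j)) ℤ.+ (1ℤ ℤ.+ q) ℤ.* + n
        ≡⟨ enum-position B j (1ℤ ℤ.+ q) ⟨
      enum B (1ℤ ℤ.+ (+ toℕ j ℤ.+ (1ℤ ℤ.+ q) ℤ.* + m))
        ≡⟨ cong (λ z → enum B (1ℤ ℤ.+ z)) (carry (+ toℕ j) q (+ m)) ⟨
      enum B (1ℤ ℤ.+ (+ (toℕ j ℕ.+ m) ℤ.+ q ℤ.* + m))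
        ≡⟨ cong (λ j → enum B (1ℤ ℤ.+ (+ j ℤ.+ q ℤ.* + m))) j+m≡ ⟩
      enum B (1ℤ ℤ.+ (+ (toℕ s ℕ.+ c) ℤ.+ q ℤ.* + m)) ∎)
    where
    r = toℕ s ℕ.+ c ℕ.∸ m
    r+m≡ : r ℕ.+ m ≡ toℕ s ℕ.+ c
    r+m≡ = ℕ.m∸n+n≡m (ℕ.≮⇒≥ s+c≮m)
    r<m : r ℕ.< m
    -- The charge is at most m, so s + c < 2m and a single carry suffices.
    r<m = ℕ.+-cancelʳ-< m r m (subst (ℕ._< m ℕ.+ m) (sym r+m≡)
      (ℕ.+-mono-<-≤ (toℕ<n s) (charge≤ (sorted A) (sorted B))))
    j = fromℕ< r<m
    j+m≡ : toℕ j ℕ.+ m ≡ toℕ s ℕ.+ c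
    j+m≡ = trans (cong (ℕ._+ m) (toℕ-fromℕ< r<m)) r+m≡

  first : ∀ (C : Row n m) i → enum C (+ suc (toℕ i)) ≡
          + suc (toℕ (lookup (sorted C) i)) ℤ.+ 0ℤ ℤ.* + n
  first C i = trans (cong (enum C ∘′ +_ ∘′ suc) (sym (ℕ.+-identityʳ (toℕ i))))
                    (enum-position C i 0ℤ)

  exceed : ∃ λ t → enum B (t ℤ.+ + c) ℤ.< enum A (t ℤ.+ 1ℤ)
  exceed with c in c≡
  -- For c = 0 the field `above` gives no witness. The last value of B in the preceding period, b_0,
  -- lies below a_1.
  ... | zero = 0ℤ , (begin-strict
      enum B 0ℤ
        ≡⟨ cong (enum B) last≡0 ⟨
      enum B (1ℤ ℤ.+ (+ toℕ last ℤ.+ ℤ.-1ℤ ℤ.* + m))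
        ≡⟨ enum-position B last ℤ.-1ℤ ⟩
      + suc (toℕ (bs last)) ℤ.+ ℤ.-1ℤ ℤ.* + n
        <⟨ lex-< {n} {_} {suc (toℕ (as zero))} {ℤ.-1ℤ} {0ℤ} (class-bound (bs last) (as zero)) ℤ.-<+ ⟩
      + suc (toℕ (as zero)) ℤ.+ 0ℤ ℤ.* + n
        ≡⟨ first A zero ⟨
      enum A 1ℤ ∎)
    where
    last : Fin m
    last = fromℕ m-1
    telescope : ∀ k → 1ℤ ℤ.+ (k ℤ.+ ℤ.-1ℤ ℤ.* (1ℤ ℤ.+ k)) ≡ 0ℤ
    telescope = solve-∀
    last≡0 : 1ℤ ℤ.+ (+ toℕ last ℤ.+ ℤ.-1ℤ ℤ.* + m) ≡ 0ℤ
    last≡0 = trans (cong (λ k → 1ℤ ℤ.+ (+ k ℤ.+ ℤ.-1ℤ ℤ.* + m)) (toℕ-fromℕ m-1))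
                   (telescope (+ m-1))
  ... | suc _ with shift .above (subst (0 ℕ.<_) (sym c≡) (s≤s z≤n))
  -- Vector indices start at 0 and `enum` at 1, so entry i of A is a_{i+1} and entry j of B is
  -- b_{j+1} = b_{i+c}; hence t = i.
  ...   | i , j , eq , bⱼ<aᵢ = + toℕ i , (begin-strict
      enum B (+ (toℕ i ℕ.+ suc _))
        ≡⟨ cong (enum B ∘′ +_) (trans (cong (toℕ i ℕ.+_) (sym c≡)) (sym eq)) ⟩
      enum B (+ suc (toℕ j))
        ≡⟨ first B j ⟩
      + suc (toℕ (bs j)) ℤ.+ 0ℤ ℤ.* + n
        <⟨ ℤ.+-monoˡ-< (0ℤ ℤ.* + n) (+<+ (s≤s bⱼ<aᵢ)) ⟩
      + suc (toℕ (as i)) ℤ.+ 0ℤ ℤ.* + n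
        ≡⟨ first A i ⟨
      enum A (+ suc (toℕ i))
        ≡⟨ cong (enum A ∘′ +_) (ℕ.+-comm 1 (toℕ i)) ⟩
      enum A (+ (toℕ i ℕ.+ 1)) ∎)

-- Proper numberings of a stream

open ProperNumbering using (at; sound; surjective; injective; southeast)

module _ {S : Stream n m} where
  open Stream S

  cellAt-injective : ∀ {t u} → cellAt t ≡ cellAt u → t ≡ u
  cellAt-injective eq = strictlyIncreasing⇒injective (enum-strictlyIncreasing rows) (cong proj₁ eq)

  shiftNumbering : ℤ → ProperNumbering S
  shiftNumbering x .at t = cellAt (t ℤ.+ x)
  shiftNumbering x .sound t = t ℤ.+ x , refl
  shiftNumbering x .surjective (t , refl) = t ℤ.- x , cong cellAt (cancel t x)
    where
    cancel : ∀ t x → (t ℤ.- x) ℤ.+ x ≡ t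
    cancel = solve-∀
  shiftNumbering x .injective {t} {u} eq = +-cancelʳ x t u (cellAt-injective eq)
  shiftNumbering x .southeast t =
    preserves-≤ (enum-strictlyIncreasing rows) t+x≤ ,
    preserves-≤ (enum-strictlyIncreasing columns) (ℤ.+-monoˡ-≤ altitude t+x≤)
    where
    t+x≤ : t ℤ.+ x ℤ.≤ (t ℤ.+ 1ℤ) ℤ.+ x
    t+x≤ = ℤ.+-monoˡ-≤ x (ℤ.i≤i+j t 1ℤ)

  module _ (N : ProperNumbering S) where

    private
      f : ℤ → ℤ
      f t = proj₁ (N .sound t)

      at≡ : ∀ t → N .at t ≡ cellAt (f t)
      at≡ t = proj₂ (N .sound t)

      f-injective : ∀ {t u} → f t ≡ f u → t ≡ u
      f-injective {t} {u} eq =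
        N .injective (trans (at≡ t) (trans (cong cellAt eq) (sym (at≡ u))))

      f-surjective : ∀ u → ∃ λ t → f t ≡ u
      f-surjective u with N .surjective (u , refl)
      ... | t , eq = t , cellAt-injective (trans (sym (at≡ t)) eq)

      f-step : ∀ t → f t ℤ.≤ f (ℤ.suc t)
      f-step t = reflects-≤ (enum-strictlyIncreasing rows)
        (subst₂ ℤ._≤_ (cong proj₁ (at≡ t))
          (trans (cong proj₁ (at≡ (t ℤ.+ 1ℤ))) (cong (enum rows ∘′ f) (ℤ.+-comm t 1ℤ)))
          (proj₁ (N .southeast t)))

      f-mono-+ : ∀ t k → f t ℤ.≤ f (+ k ℤ.+ t)
      f-mono-+ t zero    = ℤ.≤-reflexive (cong f (sym (ℤ.+-identityˡ t)))
      f-mono-+ t (suc k) = ℤ.≤-trans (f-mono-+ t k)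
        (ℤ.≤-trans (f-step (+ k ℤ.+ t)) (ℤ.≤-reflexive (cong f (sym (ℤ.+-assoc 1ℤ (+ k) t)))))

      f-mono : ∀ {t u} → t ℤ.≤ u → f t ℤ.≤ f u
      f-mono {t} {u} t≤u with u ℤ.- t in eq | ℤ.i≤j⇒0≤j-i t≤u
      ... | + k | _ = subst (λ v → f t ℤ.≤ f v)
        (trans (cong (ℤ._+ t) (sym eq)) (cancel u t)) (f-mono-+ t k)
        where
        cancel : ∀ u t → (u ℤ.- t) ℤ.+ t ≡ u
        cancel = solve-∀

      -- Surjectivity gives u with f u = f t + 1, and monotonicity forces t < u, so f (t + 1) is at
      -- most f t + 1. Injectivity excludes f (t + 1) = f t.
      f-suc : ∀ t → f (ℤ.suc t) ≡ ℤ.suc (f t)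
      f-suc t with f-surjective (ℤ.suc (f t))
      ... | u , fu≡ = ℤ.≤-antisym
        (subst (f (ℤ.suc t) ℤ.≤_) fu≡ (f-mono (ℤ.i<j⇒suc[i]≤j t<u)))
        (ℤ.i<j⇒suc[i]≤j (ℤ.≤∧≢⇒< (f-step t)
          (λ eq → ℤ.<⇒≢ (i<suc[i] t) (f-injective eq))))
        where
        t<u : t ℤ.< u
        t<u = ℤ.≰⇒> λ u≤t → ℤ.<⇒≱ (i<suc[i] (f t)) (subst (ℤ._≤ f t) fu≡ (f-mono u≤t))

      f-translate : ∀ t → f t ≡ t ℤ.+ f 0ℤ
      f-translate (+ zero)    = sym (ℤ.+-identityˡ (f 0ℤ))
      f-translate (+ suc k)   = begin
        f (+ suc k)              ≡⟨ f-suc (+ k) ⟩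
        ℤ.suc (f (+ k))          ≡⟨ cong ℤ.suc (f-translate (+ k)) ⟩
        ℤ.suc (+ k ℤ.+ f 0ℤ)     ≡⟨ ℤ.+-assoc 1ℤ (+ k) (f 0ℤ) ⟨
        + suc k ℤ.+ f 0ℤ         ∎
        where open ≡-Reasoning
      f-translate -[1+ k ]    = +-cancelˡ 1ℤ _ _ (begin
        ℤ.suc (f -[1+ k ])              ≡⟨ f-suc -[1+ k ] ⟨
        f (ℤ.suc -[1+ k ])              ≡⟨ next k ⟩
        ℤ.suc -[1+ k ] ℤ.+ f 0ℤ         ≡⟨ ℤ.+-assoc 1ℤ -[1+ k ] (f 0ℤ) ⟩
        ℤ.suc (-[1+ k ] ℤ.+ f 0ℤ)       ∎)
        where
        open ≡-Reasoning
        -- Splitting on k lets the successor compute, to 0 or to the previous negative integer, so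
        -- that the recursion descends towards 0.
        next : ∀ k → f (ℤ.suc -[1+ k ]) ≡ ℤ.suc -[1+ k ] ℤ.+ f 0ℤ
        next zero    = f-translate 0ℤ
        next (suc k) = f-translate -[1+ k ]

    -- The map f from numbers to standard indices is a monotone bijection of the integers, hence a
    -- translation.
    properNumbering-translates : ∃ λ x → ∀ t → N .at t ≡ cellAt (t ℤ.+ x)
    properNumbering-translates = f 0ℤ , λ t → trans (at≡ t) (cong cellAt (f-translate t))

-- Concurrency and the altitude

module _ {{_ : NonZero m}} (A A′ B B′ : Row n m)
         (A#A′ : DisjointRows A A′) (B#B′ : DisjointRows B B′) where

  private
    cᴬ cᴮ : ℤ
    cᴬ = + rowCharge A A′
    cᴮ = + rowCharge B B′

    offsetᴬ : Offset (enum A) (enum A′) cᴬ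
    offsetᴬ = enum-offset A A′ A#A′

    offsetᴮ : Offset (enum B) (enum B′) cᴮ
    offsetᴮ = enum-offset B B′ B#B′

    +0 : ∀ t → t ≡ t ℤ.+ 0ℤ
    +0 = solve-∀

    +0+0 : ∀ t → t ≡ (t ℤ.+ 0ℤ) ℤ.+ 0ℤ
    +0+0 = solve-∀

    +cᴬ : ∀ t → t ℤ.+ cᴬ ≡ (t ℤ.+ cᴮ) ℤ.+ (cᴬ ℤ.- cᴮ)
    +cᴬ t = regroup t cᴬ cᴮ
      where
      regroup : ∀ t a b → t ℤ.+ a ≡ (t ℤ.+ b) ℤ.+ (a ℤ.- b)
      regroup = solve-∀

    north′ : ∃ λ t → enum B′ (t ℤ.+ cᴮ) ℤ.< enum B ((t ℤ.+ 1ℤ) ℤ.+ 0ℤ)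
    north′ with offsetᴮ
    ... | _ , t , lt = t , subst (λ u → enum B′ (t ℤ.+ cᴮ) ℤ.< enum B u) (+0 (t ℤ.+ 1ℤ)) lt

  open _ConcurrentTo_

  -- Numbering the second stream with shift `cᴮ` gives its rows offset `cᴮ`; the altitude then
  -- raises the offset of its columns to `cᴬ`. Both offsets being least yields the strict
  -- inequalities.
  concurrent-rowCharge : Σ⟨ cᴬ ℤ.- cᴮ ⟩ A′ B′ ConcurrentTo Σ⟨ 0ℤ ⟩ A B
  concurrent-rowCharge .noSharedLine (t , refl) (u , refl) =
    enum-apart B B′ B#B′ t u , enum-apart A A′ A#A′ (t ℤ.+ 0ℤ) (u ℤ.+ (cᴬ ℤ.- cᴮ))
  concurrent-rowCharge .X = shiftNumbering 0ℤ
  concurrent-rowCharge .Y = shiftNumbering cᴮ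
  concurrent-rowCharge .backward =
    (λ t → subst (λ u → enum B u ℤ.≤ enum B′ (t ℤ.+ cᴮ)) (+0 t) (proj₁ offsetᴮ t) ,
           subst₂ (λ u v → enum A u ℤ.≤ enum A′ v) (+0+0 t) (+cᴬ t) (proj₁ offsetᴬ t)) ,
    -- The northern witness also shows that the numbering is backward: at that index the row
    -- inequality already fails.
    proj₁ north′ , λ (le , _) → ℤ.<⇒≱ (proj₂ north′) le
  concurrent-rowCharge .north = north′
  concurrent-rowCharge .west with offsetᴬ
  ... | _ , t , lt = t , subst₂ (λ u v → enum A′ u ℤ.< enum A v) (+cᴬ t) (+0+0 (t ℤ.+ 1ℤ)) lt

  -- If the numberings are translates by x and y, rows have offset y - x and columns y + r - x.
  -- Uniqueness of offsets determines both, and r is their difference.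
  concurrent⇒altitude : ∀ {r} → Σ⟨ r ⟩ A′ B′ ConcurrentTo Σ⟨ 0ℤ ⟩ A B → r ≡ cᴬ ℤ.- cᴮ
  concurrent⇒altitude {r} C
    with properNumbering-translates (C .X) | properNumbering-translates (C .Y)
  ... | x , X≡ | y , Y≡ = begin
      r                                   ≡⟨ cancel x y r ⟩
      ((y ℤ.+ r) ℤ.- x) ℤ.- (y ℤ.- x)     ≡⟨ cong₂ ℤ._-_ sᴬ≡ sᴮ≡ ⟩
      cᴬ ℤ.- cᴮ                           ∎
    where
    open ≡-Reasoning
    cancel : ∀ x y r → r ≡ ((y ℤ.+ r) ℤ.- x) ℤ.- (y ℤ.- x)
    cancel = solve-∀
    sᴮ≡ : y ℤ.- x ≡ cᴮ
    sᴮ≡ = offset-unique (enum-strictlyIncreasing B′)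
      (offset-reindex (enum B) (enum B′) (λ _ → refl) (λ _ → refl)
      (λ t → subst₂ ℤ._≤_ (cong proj₁ (X≡ t)) (cong proj₁ (Y≡ t)) (proj₁ (proj₁ (C .backward) t)))
      (proj₁ (C .north) , subst₂ ℤ._<_ (cong proj₁ (Y≡ _)) (cong proj₁ (X≡ _)) (proj₂ (C .north))))
      offsetᴮ
    sᴬ≡ : (y ℤ.+ r) ℤ.- x ≡ cᴬ
    sᴬ≡ = offset-unique (enum-strictlyIncreasing A′)
      (offset-reindex (enum A) (enum A′) (λ t → ℤ.+-identityʳ (t ℤ.+ x)) (λ t → ℤ.+-assoc t y r)
      (λ t → subst₂ ℤ._≤_ (cong proj₂ (X≡ t)) (cong proj₂ (Y≡ t)) (proj₂ (proj₁ (C .backward) t)))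
      (proj₁ (C .west) , subst₂ ℤ._<_ (cong proj₂ (Y≡ _)) (cong proj₂ (X≡ _)) (proj₂ (C .west))))
      offsetᴬ

theorem5p10 : (n : ℕ) .{{_ : NonZero n}} (shape : Partition) (P Q : Tabloid n shape)
    (i j : Fin (Partition.len shape)) → toℕ j ≡ suc (toℕ i) →
    (eq : Partition.part shape i ≡ Partition.part shape j) →
    IsDominanceConstant P Q i j eq (+ lch P i j eq - + lch Q i j eq)
theorem5p10 n shape P Q i j j≡1+i eq =
  concurrent-rowCharge A A′ B B′ A#A′ B#B′ ,
  λ r → concurrent⇒altitude A A′ B B′ A#A′ B#B′ {r}
  where
  open Partition shape
  open Tabloid
  instance
    size≢0 : NonZero (part j)
    size≢0 = positive j
  A A′ B B′ : Row n (part j)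
  A  = resize eq (row P i)
  A′ = row P j
  B  = resize eq (row Q i)
  B′ = row Q j
  i≢j : i ≢ j
  i≢j refl = ℕ.1+n≢n (sym j≡1+i)
  A#A′ : DisjointRows A A′
  A#A′ = disjoint P i≢j
  B#B′ : DisjointRows B B′
  B#B′ = disjoint Q i≢j
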